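{- Let $\mathcal O\subset\mathbb Z^3$ be an equilateral triangle, a regular tetrahedron, a cube, or a regular octahedron (identified with its set of vertices). Let $m\ge n\ge p$ be the dimensions of the smallest box $B_{m,n,p}=\{0,\dots,m\}\times\{0,\dots,n\}\times\{0,\dots,p\}$ containing $\mathcal O$ up to integer translations and symmetries (as made precise in the context), and let $\omega(\mathcal O)$ be the cardinality of the box orbit defined in the context. Put $u=m-n$ and $v=n-p$, and for an integer $k\ge m$ put $$\Delta=\omega(\mathcal O)\,(k-m+1)(k-n+1)(k-p+1).$$ Then for every integer $k\ge m$, the number $N(\mathcal O,k)$ of distinct objects contained in the cube $B_{k,k,k}=\{0,1,\dots,k\}^3$ that are obtained from $\mathcal O$ by all possible integer translations and symmetries is $$N(\mathcal O,k)=\begin{cases}\Delta & \text{if } u=v=0,\\ 3\Delta & \text{if exactly one of } u,v \text{ is } 0,\\ 6\Delta & \text{if } u>0 \text{ and } v>0.\end{cases}$$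
   Context: Objects are identified with their vertex sets: an equilateral triangle in $\mathbb Z^3$ is a set of three distinct points of $\mathbb Z^3$ with equal pairwise Euclidean distances; a regular tetrahedron, cube, or regular octahedron in $\mathbb Z^3$ is the (4-, 8-, or 6-element) set of vertices, all in $\mathbb Z^3$, of a non-degenerate such solid. Two objects are distinct if they are different as subsets of $\mathbb Z^3$. "Symmetries" means the symmetries of the coordinate cube, i.e. the 48-element group of $3\times3$ signed permutation matrices (generated by permutations of the coordinates and sign changes of coordinates); combined with integer translations, this includes reflections such as $(x,y,z)\mapsto(m-x,y,z)$. Thus $N(\mathcal O,k)$ is the number of distinct sets of the form $g(\mathcal O)+t$ with $g$ a signed permutation matrix, $t\in\mathbb Z^3$, and $g(\mathcal O)+t\subset\{0,1,\dots,k\}^3$. For nonnegative integers $a,b,c$, $B_{a,b,c}=\{0,\dots,a\}\times\{0,\dots,b\}\times\{0,\dots,c\}$. Minimal box: up to symmetries and integer translations, $\mathcal O$ is transformed into a set $\mathcal O'$ fitting snugly into $B_{m,n,p}$ with $m\ge n\ge p$. That is, $\mathcal O'=g(\mathcal O)+t$ for some signed permutation matrix $g$ and $t\in\mathbb Z^3$, the minimum of each of the three coordinates over $\mathcal O'$ is $0$, and the maxima of the first, second and third coordinates over $\mathcal O'$ are $m$, $n$, $p$ respectively. (So $m\ge n\ge p$ are the three coordinate extents of $\mathcal O$ in decreasing order.) Box orbit: let $\mathcal S_b$ be the group of the eight transformations generated by $(x,y,z)\mapsto(m-x,y,z)$, $(x,y,z)\mapsto(x,n-y,z)$, $(x,y,z)\mapsto(x,y,p-z)$,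 and let $\mathcal S_6$ denote the group of the six permutations of the coordinates $x,y,z$. Then $$BoxOrbit(\mathcal O')=\{(s_1\circ s_2)(\mathcal O') : s_1\in\mathcal S_b,\ s_2\in\mathcal S_6,\ (s_1\circ s_2)(\mathcal O')\subset B_{m,n,p}\},$$ a set of subsets of $B_{m,n,p}$, and $\omega(\mathcal O)$ is its cardinality. -}

module Defs where

open import Level using (Level; 0ℓ) renaming (suc to lsuc)
open import Data.Bool.Base using (Bool; if_then_else_)
open import Data.Fin.Base using (Fin)
open import Data.Fin.Permutation using (Permutation′; _⟨$⟩ʳ_)
open import Data.Integer.Base as ℤ using (ℤ; +_; 0ℤ; _+_; _-_; _*_; _≤_)
open import Data.List.Base using (List; []; _∷_; length)
open import Data.List.Membership.Propositional using (_∈_)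
open import Data.List.Relation.Unary.AllPairs using (AllPairs)
open import Data.List.Relation.Unary.Unique.Propositional using (Unique)
open import Data.Nat.Base as ℕ using (ℕ; zero; suc; _∸_)
open import Data.Product.Base using (_×_; ∃; ∃-syntax; proj₁)
open import Data.Sign.Base using (Sign)
open import Data.Vec.Base using (Vec; []; _∷_; lookup; tabulate; zipWith)
open import Function.Base using (_∘_)
open import Function.Bundles using (Bijection)
open import Relation.Binary.Bundles using (Setoid)
import Relation.Binary.Construct.On as On
open import Relation.Binary.PropositionalEquality using (_≡_; _≢_)
import Relation.Binary.PropositionalEquality.Properties as ≡
open import Relation.Unary using (Pred; _⊆_; _≐_)
open import Relation.Unary.Relation.Binary.Equality using (≐-setoid)

Point : Set
Point = Vec ℤ 3

-- Subsets of ℤ³ are always compared by extensional equality _≐_.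
PointSet : Set₁
PointSet = Pred Point 0ℓ

infixl 6 _⊕_ _⊖_
infixl 7 _·_

_⊕_ _⊖_ : Point → Point → Point
_⊕_ = zipWith _+_
_⊖_ = zipWith _-_

_·_ : Point → Point → ℤ
(a ∷ b ∷ c ∷ []) · (d ∷ e ∷ f ∷ []) = a * d + b * e + c * f

𝟎 : Point
𝟎 = 0ℤ ∷ 0ℤ ∷ 0ℤ ∷ []

-- Square of the Euclidean distance; two distances are equal iff their
-- squares are.
dist² : Point → Point → ℤ
dist² x y = (x ⊖ y) · (x ⊖ y)

image : (Point → Point) → PointSet → PointSet
image f S y = ∃[ x ] (S x × f x ≡ y)

infix 4 _hasElements_

_hasElements_ : PointSet → List Point → Set
S hasElements xs = S ≐ (_∈ xs)

Equidistant : List Point → Set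
Equidistant xs = ∃[ d ] AllPairs (λ x y → dist² x y ≡ d) xs

IsEquilateralTriangle : PointSet → Set
IsEquilateralTriangle S = ∃[ xs ]
  (length xs ≡ 3 × Unique xs × Equidistant xs × S hasElements xs)

-- Four equidistant points of ℝ³ are never coplanar, so non-degeneracy is
-- automatic.
IsRegularTetrahedron : PointSet → Set
IsRegularTetrahedron S = ∃[ xs ]
  (length xs ≡ 4 × Unique xs × Equidistant xs × S hasElements xs)

-- Nonzero, pairwise orthogonal vectors of the same length.
OrthogonalFrame : Point → Point → Point → Set
OrthogonalFrame u v w =
  u ≢ 𝟎 ×
  u · u ≡ v · v × v · v ≡ w · w ×
  u · v ≡ 0ℤ × v · w ≡ 0ℤ × w · u ≡ 0ℤ

-- A vertex o together with the three edge vectors at o.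
IsCube : PointSet → Set
IsCube S = ∃[ o ] ∃[ u ] ∃[ v ] ∃[ w ]
  (OrthogonalFrame u v w ×
   S hasElements
     (o         ∷ o ⊕ u     ∷ o ⊕ v     ∷ o ⊕ w ∷
      o ⊕ u ⊕ v ∷ o ⊕ v ⊕ w ∷ o ⊕ w ⊕ u ∷ o ⊕ u ⊕ v ⊕ w ∷ []))

-- Three diagonals aa′, bb′, cc′ with a common midpoint, of equal length and
-- pairwise perpendicular.  The midpoint itself is not required to be in ℤ³.
IsRegularOctahedron : PointSet → Set
IsRegularOctahedron S =
  ∃[ a ] ∃[ a′ ] ∃[ b ] ∃[ b′ ] ∃[ c ] ∃[ c′ ]
    (a ⊕ a′ ≡ b ⊕ b′ × b ⊕ b′ ≡ c ⊕ c′ ×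
     OrthogonalFrame (a ⊖ a′) (b ⊖ b′) (c ⊖ c′) ×
     S hasElements (a ∷ a′ ∷ b ∷ b′ ∷ c ∷ c′ ∷ []))

permute : Permutation′ 3 → Point → Point
permute π x = tabulate λ i → lookup x (π ⟨$⟩ʳ i)

-- The matrix whose row i has its only nonzero entry, of sign s i, in
-- column π i.
record SignedPermutation : Set where
  constructor signed
  field
    perm : Permutation′ 3
    sign : Fin 3 → Sign

act : SignedPermutation → Point → Point
act (signed π s) x = tabulate λ i → (s i ℤ.◃ 1) * lookup (permute π x) i

translate : Point → Point → Point
translate t x = x ⊕ t

Dimensions : Set
Dimensions = Vec ℕ 3

Box : Dimensions → PointSet
Box d x = ∀ i → 0ℤ ≤ lookup x i × lookup x i ≤ + lookup d i

IsMinimum IsMaximum : (Point → ℤ) → PointSet → ℤ → Set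
IsMinimum f S e = (∃[ x ] (S x × f x ≡ e)) × (∀ x → S x → e ≤ f x)
IsMaximum f S e = (∃[ x ] (S x × f x ≡ e)) × (∀ x → S x → f x ≤ e)

FitsSnugly : PointSet → Dimensions → Set
FitsSnugly S d = ∀ i →
  IsMinimum (λ x → lookup x i) S 0ℤ ×
  IsMaximum (λ x → lookup x i) S (+ lookup d i)

IsTransformOf : PointSet → PointSet → Set
IsTransformOf S T = ∃[ g ] ∃[ t ] (S ≐ image (translate t ∘ act g) T)

-- The three generating reflections commute and are involutions, so the group
-- they generate consists of the choices of the coordinates to be reflected.
reflect : Dimensions → (Fin 3 → Bool) → Point → Point
reflect d r x = tabulate λ i →
  if r i then + lookup d i - lookup x i else lookup x i

Collection : (ℓ : Level) → Set (lsuc 0ℓ Level.⊔ lsuc ℓ)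
Collection ℓ = Pred PointSet ℓ

members : ∀ {ℓ} → Collection ℓ → Setoid _ _
members 𝒞 = On.setoid {B = ∃ 𝒞} (≐-setoid Point 0ℓ) proj₁

infix 4 _hasCardinality_

_hasCardinality_ : ∀ {ℓ} → Collection ℓ → ℕ → Set _
𝒞 hasCardinality n = Bijection (≡.setoid (Fin n)) (members 𝒞)

BoxOrbit : PointSet → Dimensions → Collection 0ℓ
BoxOrbit S d T = ∃[ r ] ∃[ π ]
  (T ≐ image (reflect d r ∘ permute π) S × T ⊆ Box d)

-- N(S, k) is the cardinality of this collection.
Placements : PointSet → ℕ → Collection 0ℓ
Placements S k T = IsTransformOf T S × T ⊆ Box (k ∷ k ∷ k ∷ [])

multiplicity : (u v : ℕ) → ℕ
multiplicity zero    zero    = 1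
multiplicity zero    (suc _) = 3
multiplicity (suc _) zero    = 3
multiplicity (suc _) (suc _) = 6

-- Only used for k ≥ m ≥ n ≥ p, where the truncated subtractions are exact.
Δ : (ω k m n p : ℕ) → ℕ
Δ ω k m n p = ω ℕ.* (k ∸ m ℕ.+ 1) ℕ.* (k ∸ n ℕ.+ 1) ℕ.* (k ∸ p ℕ.+ 1)

{-# OPTIONS --safe #-}
module Submission where

-- A set contained in the cube and obtained from O is determined by three
-- independent data: the arrangement of m, n, p along the axes (1, 3 or 6
-- possibilities), the position of its minimal box (k − m + 1, k − n + 1 and k
-- − p + 1 possibilities along the edges m, n, p), and its shape within the
-- box. Once a representative permutation of the axes has been chosen for each
-- arrangement, the shape is a member of the box orbit: a permutation of the
-- axes is admitted in the box orbit exactly if it preserves the dimensions of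
-- the box. The arrangement and the position are read off the minima and
-- maxima of the coordinates of the set.

open import Defs
open import Level using (Level; 0ℓ)
open import Data.Bool.Base using (Bool; true; false; if_then_else_)
open import Data.Empty using (⊥-elim)
open import Data.Fin.Base using (Fin; zero; suc; finToFun; funToFin; toℕ; fromℕ<)
open import Data.Fin.Patterns using (0F; 1F; 2F)
import Data.Fin.Properties as Fin
open import Data.Fin.Permutation as Perm
  using (Permutation′; _⟨$⟩ʳ_; _⟨$⟩ˡ_; _∘ₚ_; flip; inverseˡ; inverseʳ; transpose)
open import Data.Integer.Base as ℤ using (ℤ; +_; 0ℤ; 1ℤ; +≤+; _◃_)
import Data.Integer.Properties as ℤ
open import Data.List.Base using (List; []; _∷_; length; map; lookup; deduplicate; mapMaybe;
  cartesianProduct; allFin)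
import Data.List.Membership.DecPropositional as DecMembership
open import Data.List.Membership.Propositional using (lose)
open import Data.List.Membership.Propositional.Properties
  using (∈-lookup; ∈-map⁺; ∈-map⁻; ∈-allFin)
import Data.List.Membership.Setoid as Membership
import Data.List.Relation.Unary.All as All
import Data.List.Relation.Unary.Any as Any
open import Data.List.Relation.Unary.AllPairs using (AllPairs; _∷_)
open import Data.List.Relation.Unary.Any using (Any)
import Data.List.Relation.Unary.Any.Properties as Any
import Data.List.Relation.Unary.Unique.DecSetoid.Properties as Unique
open import Data.Maybe.Base using (Maybe; just; nothing)
import Data.Maybe.Relation.Unary.Any as MAny
open import Data.Nat.Base as ℕ using (ℕ; zero; suc; z≤n; s≤s; _∸_; _≥_; _*_)
import Data.Nat.Properties as ℕ
open import Data.Product.Base using (_×_; _,_; ∃; ∃-syntax; proj₁; proj₂; -,_)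
open import Data.Product.Function.NonDependent.Setoid using (_×-bijection_)
open import Data.Product.Relation.Binary.Pointwise.NonDependent using (_×ₛ_; Pointwise-≡↔≡)
open import Data.Sign.Base as Sign using (Sign)
open import Data.Sum.Base using (_⊎_; inj₁; inj₂)
open import Data.Vec.Base as Vec using (Vec; []; _∷_; tabulate)
import Data.Vec.Properties as Vec
open import Data.Vec.Relation.Unary.All using ([]; _∷_)
open import Data.Vec.Relation.Unary.AllPairs using ([]; _∷_)
open import Data.Vec.Relation.Unary.Unique.Propositional using () renaming (Unique to UniqueVec)
open import Data.Vec.Relation.Unary.Unique.Propositional.Properties using (lookup-injective)
open import Algebra.Properties.CommutativeMonoid.Sum ℕ.+-0-commutativeMonoid using (sum; sum-permute)
open import Algebra.Properties.AbelianGroup ℤ.+-0-abelianGroup using () renaming (∙-cancelʳ to +ℤ-cancelʳ)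
open import Function.Base using (_∘_; id)
open import Function.Bundles using (Bijection; Inverse)
import Function.Construct.Composition as Compose
open import Function.Properties.Inverse using (Inverse⇒Bijection)
import Function.Construct.Identity as Identity
import Function.Construct.Symmetry as Symmetry
open import Relation.Binary.Bundles using (Setoid; DecSetoid)
import Relation.Binary.Construct.On as On
open import Relation.Binary.PropositionalEquality
  using (_≡_; _≢_; _≗_; _→-setoid_; refl; sym; trans; cong; cong₂; subst; subst₂; module ≡-Reasoning)
import Relation.Binary.PropositionalEquality.Properties as ≡
open import Relation.Nullary.Decidable using (Dec; yes; no; map′; _×-dec_; _→-dec_; ¬?; toWitness)
open import Relation.Nullary.Negation using (¬_; contradiction)
open import Relation.Unary using (_⊆_; _≐_; Decidable)
open import Relation.Unary.Properties using (≐-refl; ≐-sym; ≐-trans)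
open import Data.Integer.Tactic.RingSolver using (solve-∀)

private
  variable
    a ℓ : Level
    n : ℕ

-- Cardinalities of setoids

module _ (D : DecSetoid a ℓ) where
  open DecSetoid D using (_≈_; _≟_; setoid) renaming (sym to ≈-sym; trans to ≈-trans)
  open Membership setoid using () renaming (_∈_ to _∈ₛ_)

  unique-lookup-injective : ∀ {xs} → AllPairs (λ x y → ¬ x ≈ y) xs →
    ∀ i j → lookup xs i ≈ lookup xs j → i ≡ j
  unique-lookup-injective (_  ∷ _)   zero    zero    _  = refl
  unique-lookup-injective (x≉ ∷ _)   zero    (suc j) eq = contradiction eq (All.lookup x≉ (∈-lookup j))
  unique-lookup-injective (x≉ ∷ _)   (suc i) zero    eq =
    contradiction (≈-sym eq) (All.lookup x≉ (∈-lookup i))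
  unique-lookup-injective (_  ∷ xs!) (suc i) (suc j) eq = cong suc (unique-lookup-injective xs! i j eq)

  -- With equality decidable, a list that meets every class yields an exact count even if it has
  -- repetitions: one representative of each class survives deduplication. Both the arrangements and
  -- the box orbit are counted in this way.
  deduplicate-bijection : ∀ xs → (∀ x → x ∈ₛ xs) →
    Bijection (≡.setoid (Fin (length (deduplicate _≟_ xs)))) setoid
  deduplicate-bijection xs complete = record
    { to        = lookup (deduplicate _≟_ xs)
    ; cong      = λ { refl → DecSetoid.refl D }
    ; bijective = (λ {i} {j} → unique-lookup-injective (Unique.deduplicate-! D xs) i j)
                , λ x → let x∈ = Any.deduplicate⁺ _≟_ (λ y≈z x≈z → ≈-trans x≈z (≈-sym y≈z)) (complete x)
                        in Any.index x∈ , λ { refl → ≈-sym (Any.lookup-index x∈) }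
    }

infixr 2 _×-enumeration_

_×-enumeration_ : ∀ {a₁ ℓ₁ a₂ ℓ₂ k l} {A : Setoid a₁ ℓ₁} {B : Setoid a₂ ℓ₂} →
  Bijection (≡.setoid (Fin k)) A → Bijection (≡.setoid (Fin l)) B →
  Bijection (≡.setoid (Fin (k * l))) (A ×ₛ B)
f ×-enumeration g = Compose.bijection
  -- `Fin.*↔×` ends in pairs under propositional equality; the second bijection passes to the
  -- componentwise equality of the product setoid.
  (Compose.bijection (Inverse⇒Bijection Fin.*↔×) (Inverse⇒Bijection (Symmetry.inverse Pointwise-≡↔≡)))
  (f ×-bijection g)

-- Arrangements of a triple

Perm₃ : Set
Perm₃ = Permutation′ 3

permutations : List Perm₃
permutations =
  Perm.id ∷ transpose 0F 1F ∷ transpose 0F 2F ∷ transpose 1F 2F ∷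
  transpose 0F 1F ∘ₚ transpose 1F 2F ∷ transpose 1F 2F ∘ₚ transpose 0F 1F ∷ []

-- A permutation of three indices is determined pointwise by its three values, which are pairwise
-- distinct. There are finitely many such triples, so `decided` checks them all by evaluation.
permutations-complete : ∀ π → Any (Perm._≈_ π) permutations
permutations-complete π = Any.map (λ { (p , q , r) → λ { 0F → p ; 1F → q ; 2F → r } })
  (decided (π ⟨$⟩ʳ 0F) (π ⟨$⟩ʳ 1F) (π ⟨$⟩ʳ 2F)
    (λ eq → Fin.0≢1+n (injective eq))
    (λ eq → Fin.0≢1+n (Fin.suc-injective (injective eq)))
    (λ eq → Fin.0≢1+n (injective eq)))
  where
  injective : ∀ {i j} → π ⟨$⟩ʳ i ≡ π ⟨$⟩ʳ j → i ≡ j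
  injective eq = trans (sym (inverseˡ π)) (trans (cong (π ⟨$⟩ˡ_) eq) (inverseˡ π))

  decided : ∀ a b c → a ≢ b → b ≢ c → a ≢ c →
    Any (λ ρ → a ≡ ρ ⟨$⟩ʳ 0F × b ≡ ρ ⟨$⟩ʳ 1F × c ≡ ρ ⟨$⟩ʳ 2F) permutations
  decided = toWitness {a? = Fin.all? λ a → Fin.all? λ b → Fin.all? λ c →
    ¬? (a Fin.≟ b) →-dec ¬? (b Fin.≟ c) →-dec ¬? (a Fin.≟ c) →-dec
    Any.any? (λ ρ → a Fin.≟ (ρ ⟨$⟩ʳ 0F) ×-dec b Fin.≟ (ρ ⟨$⟩ʳ 1F) ×-dec c Fin.≟ (ρ ⟨$⟩ʳ 2F)) permutations} _

lookup-ext : {A : Set a} {x y : Vec A n} → Vec.lookup x ≗ Vec.lookup y → x ≡ y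
lookup-ext {x = x} {y} eq =
  trans (sym (Vec.tabulate∘lookup x)) (trans (Vec.tabulate-cong eq) (Vec.tabulate∘lookup y))

-- The classes are the cosets in the symmetric group of the stabiliser of `x`. The carrier still
-- consists of permutations, so that every class comes with a representative that can act on points.
Arrangements : {A : Set} → (Fin 3 → A) → Setoid 0ℓ 0ℓ
Arrangements {A} x = On.setoid (Fin 3 →-setoid A) (λ π → x ∘ (π ⟨$⟩ʳ_))

module _ {r : ℕ} (x : Fin 3 → Fin r) where
  arrangementDecSetoid : DecSetoid 0ℓ 0ℓ
  arrangementDecSetoid = record
    { isDecEquivalence = record
      { isEquivalence = Setoid.isEquivalence (Arrangements x)
      ; _≟_           = λ π σ → Fin.all? λ i → x (π ⟨$⟩ʳ i) Fin.≟ x (σ ⟨$⟩ʳ i)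
      }
    }

  arrangementCount : ℕ
  arrangementCount = length (deduplicate (DecSetoid._≟_ arrangementDecSetoid) permutations)

  -- Counting the arrangements of the pattern x in Fin r is a closed
  -- computation, even when the values y taken by it are variables.
  arrangements-pattern : ∀ {A : Set} (v : Vec A r) → UniqueVec v →
    ∀ y → y ≗ Vec.lookup v ∘ x →
    Bijection (≡.setoid (Fin arrangementCount)) (Arrangements y)
  arrangements-pattern v v! y y≗v∘x = Compose.bijection
    (deduplicate-bijection arrangementDecSetoid permutations λ π →
      Any.map (λ eq → cong x ∘ eq) (permutations-complete π))
    (record
      { to        = id
      ; cong      = λ {π} {σ} → same {π} {σ}
      ; bijective = (λ eq i → lookup-injective v! _ _
                       (trans (sym (y≗v∘x _)) (trans (eq i) (y≗v∘x _))))
                  , λ π → π , λ {σ} → same {σ} {π}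
      })
    where
    same : ∀ {π σ : Perm₃} → (∀ i → x (π ⟨$⟩ʳ i) ≡ x (σ ⟨$⟩ʳ i)) → ∀ i → y (π ⟨$⟩ʳ i) ≡ y (σ ⟨$⟩ʳ i)
    same eq i = trans (y≗v∘x _) (trans (cong (Vec.lookup v) (eq i)) (sym (y≗v∘x _)))

∸≡suc⇒≢ : ∀ {m n o} → m ∸ n ≡ suc o → m ≢ n
∸≡suc⇒≢ {m} eq refl = ℕ.0≢1+n (trans (sym (ℕ.n∸n≡0 m)) eq)

-- Each case names the pattern of equalities among m, n, p together with the distinct values. The
-- count of the pattern evaluates to 1, 3, 3 or 6, in agreement with `multiplicity`.
arrangements : ∀ {m n p} → m ≥ n → n ≥ p →
  Bijection (≡.setoid (Fin (multiplicity (m ∸ n) (n ∸ p))))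
            (Arrangements (Vec.lookup (m ∷ n ∷ p ∷ [])))
arrangements {m} {n} {p} m≥n n≥p with m ∸ n in m-n | n ∸ p in n-p
... | zero | zero =
  arrangements-pattern (Vec.lookup (0F ∷ 0F ∷ 0F ∷ [])) (m ∷ []) ([] ∷ []) (Vec.lookup (m ∷ n ∷ p ∷ []))
    λ { 0F → refl ; 1F → sym m≡n ; 2F → sym (trans m≡n n≡p) }
  where m≡n = ℕ.≤-antisym (ℕ.m∸n≡0⇒m≤n m-n) m≥n
        n≡p = ℕ.≤-antisym (ℕ.m∸n≡0⇒m≤n n-p) n≥p
... | zero | suc _ =
  arrangements-pattern (Vec.lookup (0F ∷ 0F ∷ 1F ∷ [])) (n ∷ p ∷ [])
    ((∸≡suc⇒≢ n-p ∷ []) ∷ [] ∷ []) (Vec.lookup (m ∷ n ∷ p ∷ []))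
    λ { 0F → ℕ.≤-antisym (ℕ.m∸n≡0⇒m≤n m-n) m≥n ; 1F → refl ; 2F → refl }
... | suc _ | zero =
  arrangements-pattern (Vec.lookup (0F ∷ 1F ∷ 1F ∷ [])) (m ∷ n ∷ [])
    ((∸≡suc⇒≢ m-n ∷ []) ∷ [] ∷ []) (Vec.lookup (m ∷ n ∷ p ∷ []))
    λ { 0F → refl ; 1F → refl ; 2F → sym (ℕ.≤-antisym (ℕ.m∸n≡0⇒m≤n n-p) n≥p) }
... | suc _ | suc _ =
  arrangements-pattern id (m ∷ n ∷ p ∷ [])
    -- If m were equal to p, then n, lying between them, would be equal to m.
    ((∸≡suc⇒≢ m-n ∷ (λ m≡p → ∸≡suc⇒≢ m-n (ℕ.≤-antisym (subst (ℕ._≤ n) (sym m≡p) n≥p) m≥n)) ∷ [])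
      ∷ (∸≡suc⇒≢ n-p ∷ []) ∷ [] ∷ []) (Vec.lookup (m ∷ n ∷ p ∷ []))
    λ _ → refl

-- Images and finiteness of point sets

private
  variable
    f g : Point → Point
    S T U : PointSet

image-cong : f ≗ g → S ≐ T → image f S ≐ image g T
image-cong f≗g (S⊆T , T⊆S) =
  (λ { (x , Sx , refl) → x , S⊆T Sx , sym (f≗g x) }) ,
  (λ { (x , Tx , refl) → x , T⊆S Tx , f≗g x })

image-∘ : image f (image g S) ≐ image (f ∘ g) S
image-∘ =
  (λ { (_ , (x , Sx , refl) , refl) → x , Sx , refl }) ,
  (λ { (x , Sx , refl) → _ , (x , Sx , refl) , refl })

image-id : f ≗ id → image f S ≐ S
image-id {S = S} f≗id =
  (λ { (x , Sx , refl) → subst S (sym (f≗id x)) Sx }) ,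
  (λ {x} Sx → x , Sx , f≗id x)

image-injective : (∀ {x y} → f x ≡ f y → x ≡ y) → image f S ≐ image f T → S ≐ T
image-injective {f = f} inj (S⊆T , T⊆S) = reflect-⊆ S⊆T , reflect-⊆ T⊆S
  where
  reflect-⊆ : ∀ {S T} → image f S ⊆ image f T → S ⊆ T
  reflect-⊆ {T = T} sub Sx with (y , Ty , fy≡fx) ← sub (-, Sx , refl) = subst T (inj fy≡fx) Ty

Finite : PointSet → Set
Finite S = ∃[ xs ] S hasElements xs

finite-resp-≐ : S ≐ T → Finite S → Finite T
finite-resp-≐ S≐T (xs , S≐xs) = xs , ≐-trans (≐-sym S≐T) S≐xs

finite-image : ∀ f → Finite S → Finite (image f S)
finite-image f (xs , S⊆xs , xs⊆S) = map f xs ,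
  (λ { (x , Sx , refl) → ∈-map⁺ f (S⊆xs Sx) }) ,
  (λ y∈ → let (x , x∈ , y≡fx) = ∈-map⁻ f y∈ in x , xs⊆S x∈ , sym y≡fx)

finite-∈? : Finite S → Decidable S
finite-∈? (xs , S⊆xs , xs⊆S) x = map′ xs⊆S S⊆xs (x ∈? xs)
  where open DecMembership (Vec.≡-dec ℤ._≟_) using (_∈?_)

finite-⊆? : {P : PointSet} → Finite S → Decidable P → Dec (S ⊆ P)
finite-⊆? (xs , S⊆xs , xs⊆S) P? = map′
  (λ xs⊆P Sx → All.lookup xs⊆P (S⊆xs Sx))
  (λ S⊆P → All.tabulate (S⊆P ∘ xs⊆S))
  (All.all? P? xs)

finite-≐? : Finite S → Finite T → Dec (S ≐ T)
finite-≐? fS fT = finite-⊆? fS (finite-∈? fT) ×-dec finite-⊆? fT (finite-∈? fS)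

-- Enumeration of the box orbit

lookup-permute : ∀ π x i → Vec.lookup (permute π x) i ≡ Vec.lookup x (π ⟨$⟩ʳ i)
lookup-permute π x i = Vec.lookup∘tabulate (λ i → Vec.lookup x (π ⟨$⟩ʳ i)) i

-- Names for the candidates in the box orbit. A choice of reflected coordinates becomes a number
-- below 8, because the functions `Fin 3 → Bool` can be listed only up to pointwise equality.
Code : Set
Code = Fin 8 × Perm₃

reflections : Fin 8 → Fin 3 → Bool
reflections c = Inverse.to Fin.2↔Bool ∘ finToFun c

encode : (Fin 3 → Bool) → Fin 8
encode r = funToFin (Inverse.from Fin.2↔Bool ∘ r)

reflections-encode : ∀ r → r ≗ reflections (encode r)
reflections-encode r i = sym (trans
  (cong (Inverse.to Fin.2↔Bool) (Fin.finToFun-funToFin (Inverse.from Fin.2↔Bool ∘ r) i))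
  (Inverse.inverseˡ Fin.2↔Bool refl))

module _ (d : Dimensions) where

  reflectCoordinate : Bool → Fin 3 → ℤ → ℤ
  reflectCoordinate b i z = if b then + Vec.lookup d i ℤ.- z else z

  lookup-reflect : ∀ r π x i → Vec.lookup (reflect d r (permute π x)) i
                             ≡ reflectCoordinate (r i) i (Vec.lookup x (π ⟨$⟩ʳ i))
  lookup-reflect r π x i =
    trans (Vec.lookup∘tabulate (λ i → reflectCoordinate (r i) i (Vec.lookup (permute π x) i)) i)
          (cong (reflectCoordinate (r i) i) (lookup-permute π x i))

  reflect-permute-cong : ∀ r r′ π π′ → r ≗ r′ → π Perm.≈ π′ →
                         reflect d r ∘ permute π ≗ reflect d r′ ∘ permute π′
  reflect-permute-cong r r′ π π′ r≗ π≈ x = lookup-ext λ i → begin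
    Vec.lookup (reflect d r (permute π x)) i
      ≡⟨ lookup-reflect r π x i ⟩
    reflectCoordinate (r i) i (Vec.lookup x (π ⟨$⟩ʳ i))
      ≡⟨ cong₂ (λ b j → reflectCoordinate b i (Vec.lookup x j)) (r≗ i) (π≈ i) ⟩
    reflectCoordinate (r′ i) i (Vec.lookup x (π′ ⟨$⟩ʳ i))
      ≡⟨ lookup-reflect r′ π′ x i ⟨
    Vec.lookup (reflect d r′ (permute π′ x)) i ∎
    where open ≡-Reasoning

  box? : Decidable (Box d)
  box? x = Fin.all? λ i → (0ℤ ℤ.≤? Vec.lookup x i) ×-dec (Vec.lookup x i ℤ.≤? + Vec.lookup d i)

  module _ (finS : Finite S) where

    boxOrbitDecSetoid : DecSetoid _ _
    boxOrbitDecSetoid = record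
      { isDecEquivalence = record
        { isEquivalence = Setoid.isEquivalence (members (BoxOrbit S d))
        ; _≟_           = λ (_ , orbT) (_ , orbU) → finite-≐? (finite orbT) (finite orbU)
        }
      }
      where
      finite : BoxOrbit S d T → Finite T
      finite (_ , _ , T≐ , _) = finite-resp-≐ (≐-sym T≐) (finite-image _ finS)

    codeImage : Code → PointSet
    codeImage (c , π) = image (reflect d (reflections c) ∘ permute π) S

    fits? : ∀ c → Dec (codeImage c ⊆ Box d)
    fits? c = finite-⊆? (finite-image _ finS) box?

    -- A candidate that leaves the box is not a member of the orbit and is dropped from the
    -- enumeration.
    decode : Code → Maybe (∃ (BoxOrbit S d))
    decode c with fits? c
    ... | yes fits = just (codeImage c , reflections (proj₁ c) , proj₂ c , ≐-refl , fits)
    ... | no  _    = nothing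

    decode-fits : ∀ {c} → T ≐ codeImage c → T ⊆ Box d → MAny.Any (λ U → T ≐ proj₁ U) (decode c)
    decode-fits {c = c} T≐ T⊆ with fits? c
    ... | yes _    = MAny.just T≐
    ... | no ¬fits = ⊥-elim (¬fits λ x∈ → T⊆ (proj₂ T≐ x∈))

    -- The image of `S` depends on `r` and `π` only through their values, so a list of codes that
    -- matches every pair pointwise decodes to a list meeting every member of the orbit. Different
    -- codes may give the same set; deduplication removes these repetitions.
    covered-cardinality : ∀ cs →
      (∀ r π → Any (λ (c , ρ) → r ≗ reflections c × π Perm.≈ ρ) cs) →
      ∃[ ω ] BoxOrbit S d hasCardinality ω
    covered-cardinality cs covered = -, deduplicate-bijection boxOrbitDecSetoid (mapMaybe decode cs)
      λ (T , r , π , T≐ , T⊆) → Any.mapMaybe⁺ decode cs (Any.map⁺ (Any.map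
        (λ {(c , ρ)} (r≗ , π≈) → decode-fits
          (≐-trans T≐ (image-cong (reflect-permute-cong r (reflections c) π ρ r≗ π≈) ≐-refl)) T⊆)
        (covered r π)))

    boxOrbit-cardinality : ∃[ ω ] BoxOrbit S d hasCardinality ω
    boxOrbit-cardinality = covered-cardinality (cartesianProduct (allFin 8) permutations)
      λ r π → Any.cartesianProduct⁺ (lose (∈-allFin (encode r)) (reflections-encode r))
                                    (permutations-complete π)

-- Coordinate extrema

Extrema : (Point → ℤ) → PointSet → ℤ → ℤ → Set
Extrema φ S lo hi = IsMinimum φ S lo × IsMaximum φ S hi

private
  variable
    φ ψ : Point → ℤ
    lo hi lo′ hi′ : ℤ

extrema-unique : Extrema φ S lo hi → Extrema φ S lo′ hi′ → lo ≡ lo′ × hi ≡ hi′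
extrema-unique (((x , Sx , refl) , ≥lo) , ((y , Sy , refl) , ≤hi))
               (((x′ , Sx′ , refl) , ≥lo′) , ((y′ , Sy′ , refl) , ≤hi′)) =
  ℤ.≤-antisym (≥lo x′ Sx′) (≥lo′ x Sx) , ℤ.≤-antisym (≤hi′ y Sy) (≤hi y′ Sy′)

extrema-resp-≐ : S ≐ T → Extrema φ S lo hi → Extrema φ T lo hi
extrema-resp-≐ (S⊆T , T⊆S) (((x , Sx , eq) , ≥lo) , ((y , Sy , eq′) , ≤hi)) =
  ((x , S⊆T Sx , eq) , λ z → ≥lo z ∘ T⊆S) , ((y , S⊆T Sy , eq′) , λ z → ≤hi z ∘ T⊆S)

extrema-image : Extrema (φ ∘ f) S lo hi → Extrema φ (image f S) lo hi
extrema-image {φ = φ} {f} (((x , Sx , eq) , ≥lo) , ((y , Sy , eq′) , ≤hi)) =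
  ((f x , (x , Sx , refl) , eq) , λ { _ (z , Sz , refl) → ≥lo z Sz }) ,
  ((f y , (y , Sy , refl) , eq′) , λ { _ (z , Sz , refl) → ≤hi z Sz })

module _ {h : ℤ → ℤ} where

  extrema-monotone : (∀ {x y} → x ℤ.≤ y → h x ℤ.≤ h y) → ψ ≗ h ∘ φ →
                     Extrema φ S lo hi → Extrema ψ S (h lo) (h hi)
  extrema-monotone mono ψ≗ (((x , Sx , refl) , ≥lo) , ((y , Sy , refl) , ≤hi)) =
    ((x , Sx , ψ≗ x) , λ z Sz → subst (_ ℤ.≤_) (sym (ψ≗ z)) (mono (≥lo z Sz))) ,
    ((y , Sy , ψ≗ y) , λ z Sz → subst (ℤ._≤ _) (sym (ψ≗ z)) (mono (≤hi z Sz)))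

  extrema-antitone : (∀ {x y} → x ℤ.≤ y → h y ℤ.≤ h x) → ψ ≗ h ∘ φ →
                     Extrema φ S lo hi → Extrema ψ S (h hi) (h lo)
  extrema-antitone anti ψ≗ (((x , Sx , refl) , ≥lo) , ((y , Sy , refl) , ≤hi)) =
    ((y , Sy , ψ≗ y) , λ z Sz → subst (_ ℤ.≤_) (sym (ψ≗ z)) (anti (≤hi z Sz))) ,
    ((x , Sx , ψ≗ x) , λ z Sz → subst (ℤ._≤ _) (sym (ψ≗ z)) (anti (≥lo z Sz)))

extrema-box : ∀ d i → Extrema (λ x → Vec.lookup x i) S lo hi → S ⊆ Box d →
              0ℤ ℤ.≤ lo × hi ℤ.≤ + Vec.lookup d i
extrema-box d i (((_ , Sx , refl) , _) , ((_ , Sy , refl) , _)) S⊆Box =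
  proj₁ (S⊆Box Sx i) , proj₂ (S⊆Box Sy i)

-- Members of the box orbit are snug

sum-mono-≤ : {f g : Fin n → ℕ} → (∀ i → f i ℕ.≤ g i) → sum f ℕ.≤ sum g
sum-mono-≤ {zero}  f≤g = z≤n
sum-mono-≤ {suc n} f≤g = ℕ.+-mono-≤ (f≤g zero) (sum-mono-≤ (f≤g ∘ suc))

-- A strict inequality at one index could not be made up for at the others.
≤∧sum≡⇒≗ : {f g : Fin n → ℕ} → (∀ i → f i ℕ.≤ g i) → sum f ≡ sum g → f ≗ g
≤∧sum≡⇒≗ {suc n} {f} {g} f≤g eq = λ { zero → head ; (suc i) → ≤∧sum≡⇒≗ (f≤g ∘ suc) tail i }
  where
  head : f zero ≡ g zero
  head = ℕ.≤-antisym (f≤g zero) (ℕ.+-cancelʳ-≤ (sum (g ∘ suc)) _ _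
    (subst (ℕ._≤ f zero ℕ.+ sum (g ∘ suc)) eq (ℕ.+-monoʳ-≤ (f zero) (sum-mono-≤ (f≤g ∘ suc)))))
  tail : sum (f ∘ suc) ≡ sum (g ∘ suc)
  tail = ℕ.+-cancelˡ-≡ (f zero) _ _ (trans eq (cong (ℕ._+ sum (g ∘ suc)) (sym head)))

-- Permuting the terms leaves the sum unchanged, so no term can drop.
permuted-≤⇒≡ : ∀ (f : Fin n → ℕ) (π : Permutation′ n) →
               (∀ i → f (π ⟨$⟩ʳ i) ℕ.≤ f i) → ∀ i → f (π ⟨$⟩ʳ i) ≡ f i
permuted-≤⇒≡ f π le = ≤∧sum≡⇒≗ le (sym (sum-permute f π))

module _ (d : Dimensions) where

  -- The permutation brings the range from 0 to E onto axis i, and the reflection z ↦ D - z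
  -- exchanges its ends, sending 0 to D - 0 and E to D - E. Here E and D may still differ.
  reflect-extrema : ∀ r π i → FitsSnugly S d →
    let D = + Vec.lookup d i; E = + Vec.lookup d (π ⟨$⟩ʳ i) in
    Extrema (λ x → Vec.lookup x i) (image (reflect d r ∘ permute π) S)
            (if r i then D ℤ.- E else 0ℤ) (if r i then D ℤ.- 0ℤ else E)
  reflect-extrema {S = S} r π i snug = extrema-image (cases (r i) (λ x → lookup-reflect d r π x i))
    where
    cases : ∀ b {ψ} → (∀ x → ψ x ≡ reflectCoordinate d b i (Vec.lookup x (π ⟨$⟩ʳ i))) →
            let D = + Vec.lookup d i; E = + Vec.lookup d (π ⟨$⟩ʳ i) in
            Extrema ψ S (if b then D ℤ.- E else 0ℤ) (if b then D ℤ.- 0ℤ else E)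
    cases false eq = extrema-monotone {h = id} id eq (snug (π ⟨$⟩ʳ i))
    cases true  eq = extrema-antitone {h = λ z → + Vec.lookup d i ℤ.- z}
      (ℤ.+-monoʳ-≤ (+ Vec.lookup d i) ∘ ℤ.neg-mono-≤) eq (snug (π ⟨$⟩ʳ i))

  -- Once E = D, the reflection merely swaps the ends 0 and D of the range.
  reflect-snug : ∀ r π → FitsSnugly S d → (∀ i → Vec.lookup d (π ⟨$⟩ʳ i) ≡ Vec.lookup d i) →
                 FitsSnugly (image (reflect d r ∘ permute π) S) d
  reflect-snug {S = S} r π snug eq i with r i | reflect-extrema r π i snug
  ... | false | ext rewrite eq i = ext
  ... | true  | ext rewrite eq i = subst₂ (Extrema _ _) (ℤ.+-inverseʳ D) (ℤ.+-identityʳ D) ext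
    where D = + Vec.lookup d i

  -- Containment in the box means that no extent exceeds the corresponding
  -- dimension; the extents being a permutation of the dimensions, they agree.
  boxOrbit⇒snug : FitsSnugly S d → BoxOrbit S d T → FitsSnugly T d
  boxOrbit⇒snug {S = S} {T = T} snug (r , π , T≐ , T⊆) i = extrema-resp-≐ (≐-sym T≐)
    (reflect-snug r π snug (permuted-≤⇒≡ (Vec.lookup d) π bound) i)
    where
    bound : ∀ i → Vec.lookup d (π ⟨$⟩ʳ i) ℕ.≤ Vec.lookup d i
    bound i with r i | extrema-box d i (reflect-extrema r π i snug) (T⊆ ∘ proj₂ T≐)
    ... | false | _ , E≤D   = ℤ.drop‿+≤+ E≤D
    ... | true  | 0≤D-E , _ = ℤ.drop‿+≤+ (ℤ.0≤i-j⇒j≤i 0≤D-E)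

  snug⇒box : FitsSnugly S d → S ⊆ Box d
  snug⇒box snug {x} Sx i = proj₂ (proj₁ (snug i)) x Sx , proj₂ (proj₂ (snug i)) x Sx

-- Signed permutations with translations form a group

unit : Sign → ℤ
unit s = s ◃ 1

unit² : ∀ s → unit s ℤ.* unit s ≡ 1ℤ
unit² Sign.- = refl
unit² Sign.+ = refl

affine : Perm₃ → (Fin 3 → Sign) → (Fin 3 → ℤ) → Point → Fin 3 → ℤ
affine π s t x i = unit (s i) ℤ.* Vec.lookup x (π ⟨$⟩ʳ i) ℤ.+ t i

lookup-affine : ∀ π s t x → Vec.lookup (translate t (act (signed π s) x)) ≗ affine π s (Vec.lookup t) x
lookup-affine π s t x i = trans (Vec.lookup-zipWith ℤ._+_ i (act (signed π s) x) t)
  (cong (ℤ._+ Vec.lookup t i)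
    (trans (Vec.lookup∘tabulate (λ i → unit (s i) ℤ.* Vec.lookup (permute π x) i) i)
           (cong (unit (s i) ℤ.*_) (lookup-permute π x i))))

-- Recognises a transform by its coordinates. Composites, inverses, placements and the maps of the
-- box orbit are all shown to be transforms by this criterion.
affine⇒transform : ∀ f π s t → (∀ x → Vec.lookup (f x) ≗ affine π s t x) →
                   T ≐ image f S → IsTransformOf T S
affine⇒transform f π s t f≗ T≐ = signed π s , tabulate t , ≐-trans T≐ (image-cong
  (λ x → lookup-ext λ i → trans (f≗ x i) (sym (trans (lookup-affine π s (tabulate t) x i)
    (cong (λ z → unit (s i) ℤ.* Vec.lookup x (π ⟨$⟩ʳ i) ℤ.+ z) (Vec.lookup∘tabulate t i)))))
  ≐-refl)

transform-trans : IsTransformOf S T → IsTransformOf T U → IsTransformOf S U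
transform-trans (signed π s , t , S≐) (signed π′ s′ , t′ , T≐) =
  affine⇒transform (translate t ∘ act (signed π s) ∘ translate t′ ∘ act (signed π′ s′))
    -- Coordinate i of the outer map reads coordinate π i of the inner one, which reads coordinate
    -- π′ (π i) of x. The inner sign and offset are therefore taken at π i.
    (π ∘ₚ π′) (λ i → s i Sign.* s′ (π ⟨$⟩ʳ i))
    (λ i → unit (s i) ℤ.* Vec.lookup t′ (π ⟨$⟩ʳ i) ℤ.+ Vec.lookup t i)
    (λ x i → let j = π ⟨$⟩ʳ i; e = unit (s i); e′ = unit (s′ j); z = Vec.lookup x (π′ ⟨$⟩ʳ j) in begin
      Vec.lookup (translate t (act (signed π s) (translate t′ (act (signed π′ s′) x)))) i
        ≡⟨ lookup-affine π s t (translate t′ (act (signed π′ s′) x)) i ⟩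
      e ℤ.* Vec.lookup (translate t′ (act (signed π′ s′) x)) j ℤ.+ Vec.lookup t i
        ≡⟨ cong (λ w → e ℤ.* w ℤ.+ Vec.lookup t i) (lookup-affine π′ s′ t′ x j) ⟩
      e ℤ.* (e′ ℤ.* z ℤ.+ Vec.lookup t′ j) ℤ.+ Vec.lookup t i
        ≡⟨ expand e e′ z (Vec.lookup t′ j) (Vec.lookup t i) ⟩
      (e ℤ.* e′) ℤ.* z ℤ.+ (e ℤ.* Vec.lookup t′ j ℤ.+ Vec.lookup t i)
        ≡⟨ cong (λ w → w ℤ.* z ℤ.+ (e ℤ.* Vec.lookup t′ j ℤ.+ Vec.lookup t i))
             (ℤ.◃-distrib-* (s i) (s′ j) 1 1) ⟨
      unit (s i Sign.* s′ j) ℤ.* z ℤ.+ (e ℤ.* Vec.lookup t′ j ℤ.+ Vec.lookup t i) ∎)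
    (≐-trans S≐ (≐-trans (image-cong (λ _ → refl) T≐) image-∘))
  where
  open ≡-Reasoning
  expand : ∀ e e′ z t′ t → e ℤ.* (e′ ℤ.* z ℤ.+ t′) ℤ.+ t ≡ (e ℤ.* e′) ℤ.* z ℤ.+ (e ℤ.* t′ ℤ.+ t)
  expand = solve-∀

-- With i = π⁻¹ j, the equation y_i = e x_j + t_i has the solution x_j = e y_i - e t_i, since e² =
-- 1.
transform-sym : IsTransformOf S T → IsTransformOf T S
transform-sym {S = S} {T = T} (signed π s , t , S≐) =
  affine⇒transform (tabulate ∘ affine (flip π) s⁻¹ t⁻¹) (flip π) s⁻¹ t⁻¹
    (λ x → Vec.lookup∘tabulate (affine (flip π) s⁻¹ t⁻¹ x))
    (≐-sym (≐-trans (image-cong (λ _ → refl) S≐) (≐-trans image-∘ (image-id inverse))))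
  where
  open ≡-Reasoning
  s⁻¹ : Fin 3 → Sign
  s⁻¹ j = s (π ⟨$⟩ˡ j)
  t⁻¹ : Fin 3 → ℤ
  t⁻¹ j = ℤ.- (unit (s⁻¹ j) ℤ.* Vec.lookup t (π ⟨$⟩ˡ j))

  cancel : ∀ e z t → e ℤ.* (e ℤ.* z ℤ.+ t) ℤ.+ ℤ.- (e ℤ.* t) ≡ (e ℤ.* e) ℤ.* z
  cancel = solve-∀

  inverse : tabulate ∘ affine (flip π) s⁻¹ t⁻¹ ∘ translate t ∘ act (signed π s) ≗ id
  inverse x = lookup-ext λ j → let i = π ⟨$⟩ˡ j; e = unit (s i) in begin
    Vec.lookup (tabulate (affine (flip π) s⁻¹ t⁻¹ (translate t (act (signed π s) x)))) j
      ≡⟨ Vec.lookup∘tabulate (affine (flip π) s⁻¹ t⁻¹ (translate t (act (signed π s) x))) j ⟩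
    e ℤ.* Vec.lookup (translate t (act (signed π s) x)) i ℤ.+ t⁻¹ j
      ≡⟨ cong (λ w → e ℤ.* w ℤ.+ t⁻¹ j) (lookup-affine π s t x i) ⟩
    e ℤ.* (e ℤ.* Vec.lookup x (π ⟨$⟩ʳ i) ℤ.+ Vec.lookup t i) ℤ.+ t⁻¹ j
      ≡⟨ cancel e (Vec.lookup x (π ⟨$⟩ʳ i)) (Vec.lookup t i) ⟩
    (e ℤ.* e) ℤ.* Vec.lookup x (π ⟨$⟩ʳ i)
      ≡⟨ cong₂ (λ u l → u ℤ.* Vec.lookup x l) (unit² (s i)) (inverseʳ π) ⟩
    1ℤ ℤ.* Vec.lookup x j
      ≡⟨ ℤ.*-identityˡ _ ⟩
    Vec.lookup x j ∎

finite-transform : IsTransformOf S T → Finite T → Finite S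
finite-transform (_ , _ , S≐) finT = finite-resp-≐ (≐-sym S≐) (finite-image _ finT)

-- Placing snug sets in a cube

-- The translation comes first, so that the offset `s` is measured along the edges m, n, p of the
-- box and its admissible range does not depend on `ρ`.
place : Perm₃ → Point → Point → Point
place ρ s = permute ρ ∘ translate s

lookup-place : ∀ ρ s x i → Vec.lookup (place ρ s x) i
                         ≡ Vec.lookup x (ρ ⟨$⟩ʳ i) ℤ.+ Vec.lookup s (ρ ⟨$⟩ʳ i)
lookup-place ρ s x i = trans (lookup-permute ρ (translate s x) i) (Vec.lookup-zipWith ℤ._+_ (ρ ⟨$⟩ʳ i) x s)

-- Facts about a placed set arise at the indices ρ i; as ρ is surjective, these are all the indices.
along : ∀ (ρ : Perm₃) {P : Fin 3 → Set} → (∀ i → P (ρ ⟨$⟩ʳ i)) → ∀ i → P i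
along ρ {P} p i = subst P (inverseʳ ρ) (p (ρ ⟨$⟩ˡ i))

place-injective : ∀ ρ s {x y} → place ρ s x ≡ place ρ s y → x ≡ y
place-injective ρ s {x} {y} eq = lookup-ext (along ρ λ i → +ℤ-cancelʳ (Vec.lookup s (ρ ⟨$⟩ʳ i)) _ _
  (trans (sym (lookup-place ρ s x i)) (trans (cong (λ z → Vec.lookup z i) eq) (lookup-place ρ s y i))))

place-transform : ∀ ρ s → IsTransformOf (image (place ρ s) S) S
place-transform ρ s = affine⇒transform (place ρ s) ρ (λ _ → Sign.+) (λ i → Vec.lookup s (ρ ⟨$⟩ʳ i))
  (λ x i → trans (lookup-place ρ s x i)
    (cong (ℤ._+ Vec.lookup s (ρ ⟨$⟩ʳ i)) (sym (ℤ.*-identityˡ (Vec.lookup x (ρ ⟨$⟩ʳ i))))))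
  ≐-refl

place-extrema : ∀ d ρ s i → FitsSnugly S d →
  Extrema (λ x → Vec.lookup x i) (image (place ρ s) S)
    (Vec.lookup s (ρ ⟨$⟩ʳ i)) (+ Vec.lookup d (ρ ⟨$⟩ʳ i) ℤ.+ Vec.lookup s (ρ ⟨$⟩ʳ i))
place-extrema d ρ s i snug = extrema-image (subst
  (λ l → Extrema (λ x → Vec.lookup (place ρ s x) i) _ l
                 (+ Vec.lookup d (ρ ⟨$⟩ʳ i) ℤ.+ Vec.lookup s (ρ ⟨$⟩ʳ i)))
  (ℤ.+-identityˡ _)
  (extrema-monotone {h = λ z → z ℤ.+ Vec.lookup s (ρ ⟨$⟩ʳ i)} (ℤ.+-monoˡ-≤ (Vec.lookup s (ρ ⟨$⟩ʳ i)))
    (λ x → lookup-place ρ s x i) (snug (ρ ⟨$⟩ʳ i))))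

-- The minima of the coordinates are the offsets, and the maxima exceed them by the dimensions; both
-- depend only on the placed set.
place-unique : ∀ d ρ ρ′ s s′ → FitsSnugly S d → FitsSnugly T d →
  image (place ρ s) S ≐ image (place ρ′ s′) T → ∀ i →
  Vec.lookup s (ρ ⟨$⟩ʳ i) ≡ Vec.lookup s′ (ρ′ ⟨$⟩ʳ i) ×
  Vec.lookup d (ρ ⟨$⟩ʳ i) ≡ Vec.lookup d (ρ′ ⟨$⟩ʳ i)
place-unique d ρ ρ′ s s′ snugS snugT eq i
  with lo≡ , hi≡ ← extrema-unique (extrema-resp-≐ eq (place-extrema d ρ s i snugS))
                                  (place-extrema d ρ′ s′ i snugT) =
  lo≡ , ℤ.+-injective (+ℤ-cancelʳ (Vec.lookup s (ρ ⟨$⟩ʳ i)) _ _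
    (trans hi≡ (cong (λ z → + Vec.lookup d (ρ′ ⟨$⟩ʳ i) ℤ.+ z) (sym lo≡))))

-- For a common permutation the extrema force equal offsets. Both sets are then moved by the same
-- injective map, which can be cancelled.
place-cancel : ∀ d ρ s s′ → FitsSnugly S d → FitsSnugly T d →
  image (place ρ s) S ≐ image (place ρ s′) T → s ≡ s′ × S ≐ T
place-cancel {S = S} {T = T} d ρ s s′ snugS snugT eq = s≡s′ , image-injective (place-injective ρ s)
  (subst (λ z → image (place ρ s) S ≐ image (place ρ z) T) (sym s≡s′) eq)
  where
  s≡s′ : s ≡ s′
  s≡s′ = lookup-ext (along ρ λ i → proj₁ (place-unique d ρ ρ s s′ snugS snugT eq i))

boxOrbit⇒transform : ∀ d → BoxOrbit S d T → IsTransformOf T S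
boxOrbit⇒transform d (r , π , T≐ , _) = affine⇒transform (reflect d r ∘ permute π) π
  (λ i → if r i then Sign.- else Sign.+) (λ i → if r i then + Vec.lookup d i else 0ℤ)
  (λ x i → trans (lookup-reflect d r π x i) (linear (r i) (+ Vec.lookup d i) (Vec.lookup x (π ⟨$⟩ʳ i))))
  T≐
  where
  linear : ∀ b D z → (if b then D ℤ.- z else z)
                   ≡ unit (if b then Sign.- else Sign.+) ℤ.* z ℤ.+ (if b then D else 0ℤ)
  linear true  D z = identity D z
    where identity : ∀ D z → D ℤ.- z ≡ ℤ.- 1ℤ ℤ.* z ℤ.+ D
          identity = solve-∀
  linear false D z = identity z
    where identity : ∀ z → z ≡ 1ℤ ℤ.* z ℤ.+ 0ℤ
          identity = solve-∀

cube : ℕ → Dimensions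
cube k = k ∷ k ∷ k ∷ []

lookup-cube : ∀ k i → Vec.lookup (cube k) i ≡ k
lookup-cube k 0F = refl
lookup-cube k 1F = refl
lookup-cube k 2F = refl

Within : Dimensions → ℕ → Point → Set
Within d k s = ∀ i → 0ℤ ℤ.≤ Vec.lookup s i × + Vec.lookup d i ℤ.+ Vec.lookup s i ℤ.≤ + k

place-within⇒box : ∀ d k ρ s → FitsSnugly S d → Within d k s → image (place ρ s) S ⊆ Box (cube k)
place-within⇒box d k ρ s snug within {y} y∈ i
  with ((_ , ≥lo) , (_ , ≤hi)) ← place-extrema d ρ s i snug rewrite lookup-cube k i =
  ℤ.≤-trans (proj₁ (within (ρ ⟨$⟩ʳ i))) (≥lo y y∈) , ℤ.≤-trans (≤hi y y∈) (proj₂ (within (ρ ⟨$⟩ʳ i)))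

place-box⇒within : ∀ d k ρ s → FitsSnugly S d → image (place ρ s) S ⊆ Box (cube k) → Within d k s
place-box⇒within d k ρ s snug ⊆Box = along ρ λ i →
  let (0≤ , ≤k) = extrema-box (cube k) i (place-extrema d ρ s i snug) ⊆Box in
  0≤ , subst (λ l → _ ℤ.≤ + l) (lookup-cube k i) ≤k

negative? : Sign → Bool
negative? Sign.- = true
negative? Sign.+ = false

-- As π and ρ arrange d alike, σ i = π (ρ⁻¹ i) preserves d, so it contributes a
-- member of the box orbit. Reflecting z ↦ − z differs from z ↦ D − z by a
-- translation, which is absorbed in the offset.
transform⇒place : ∀ d ρ → FitsSnugly S d → ∀ π →
  (∀ i → Vec.lookup d (ρ ⟨$⟩ʳ i) ≡ Vec.lookup d (π ⟨$⟩ʳ i)) → ∀ s t →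
  ∃[ T ] ∃[ z ] (BoxOrbit S d T × image (translate t ∘ act (signed π s)) S ≐ image (place ρ z) T)
transform⇒place {S = S} d ρ snug π dρ≡dπ s t =
  image (reflect d r ∘ permute σ) S , offset ,
  (r , σ , ≐-refl , snug⇒box d (reflect-snug d r σ snug dσ≡d)) ,
  ≐-trans (image-cong agree ≐-refl) (≐-sym image-∘)
  where
  open ≡-Reasoning
  σ : Perm₃
  σ = flip ρ ∘ₚ π
  r : Fin 3 → Bool
  r i = negative? (s (ρ ⟨$⟩ˡ i))
  shift : Bool → Fin 3 → ℤ
  shift b i = if b then + Vec.lookup d i else 0ℤ
  shifts : Fin 3 → ℤ
  shifts i = Vec.lookup t (ρ ⟨$⟩ˡ i) ℤ.- shift (r i) i
  offset : Point
  offset = tabulate shifts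

  dσ≡d : ∀ i → Vec.lookup d (σ ⟨$⟩ʳ i) ≡ Vec.lookup d i
  dσ≡d i = trans (sym (dρ≡dπ (ρ ⟨$⟩ˡ i))) (cong (Vec.lookup d) (inverseʳ ρ))

  reflected : ∀ e i z u → reflectCoordinate d (negative? e) i z ℤ.+ (u ℤ.- shift (negative? e) i)
                        ≡ unit e ℤ.* z ℤ.+ u
  reflected Sign.- i z u = identity (+ Vec.lookup d i) z u
    where identity : ∀ D z u → (D ℤ.- z) ℤ.+ (u ℤ.- D) ≡ ℤ.- 1ℤ ℤ.* z ℤ.+ u
          identity = solve-∀
  reflected Sign.+ i z u = identity z u
    where identity : ∀ z u → z ℤ.+ (u ℤ.- 0ℤ) ≡ 1ℤ ℤ.* z ℤ.+ u
          identity = solve-∀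

  agree : translate t ∘ act (signed π s) ≗ place ρ offset ∘ reflect d r ∘ permute σ
  agree x = lookup-ext λ i → let l = ρ ⟨$⟩ʳ i in begin
    Vec.lookup (translate t (act (signed π s) x)) i
      ≡⟨ lookup-affine π s t x i ⟩
    affine π s (Vec.lookup t) x i
      ≡⟨ cong (affine π s (Vec.lookup t) x) (inverseˡ ρ) ⟨
    affine π s (Vec.lookup t) x (ρ ⟨$⟩ˡ l)
      ≡⟨ reflected (s (ρ ⟨$⟩ˡ l)) l (Vec.lookup x (σ ⟨$⟩ʳ l)) (Vec.lookup t (ρ ⟨$⟩ˡ l)) ⟨
    reflectCoordinate d (r l) l (Vec.lookup x (σ ⟨$⟩ʳ l)) ℤ.+ shifts l
      ≡⟨ cong₂ ℤ._+_ (lookup-reflect d r σ x l) (Vec.lookup∘tabulate shifts l) ⟨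
    Vec.lookup (reflect d r (permute σ x)) l ℤ.+ Vec.lookup offset l
      ≡⟨ lookup-place ρ offset (reflect d r (permute σ x)) i ⟨
    Vec.lookup (place ρ offset (reflect d r (permute σ x))) i ∎

-- An edge of length e ≤ k fits into {0, ..., k} at the offsets 0, ..., k - e, both ends included.
-- The size is written exactly as the corresponding factor of `Δ`.
Positions : (k e : ℕ) → Set
Positions k e = Fin (k ∸ e ℕ.+ 1)

position-within : ∀ {k e} → k ≥ e → (c : Positions k e) → + e ℤ.+ + toℕ c ℤ.≤ + k
position-within {k} {e} k≥e c = +≤+ (ℕ.≤-trans
  (ℕ.+-monoʳ-≤ e (ℕ.s≤s⁻¹ (subst (toℕ c ℕ.<_) (ℕ.+-comm (k ∸ e) 1) (Fin.toℕ<n c))))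
  (ℕ.≤-reflexive (ℕ.m+[n∸m]≡n k≥e)))

within-position : ∀ {k e z} → 0ℤ ℤ.≤ z → + e ℤ.+ z ℤ.≤ + k → ∃[ c ] + toℕ {k ∸ e ℕ.+ 1} c ≡ z
within-position {k} {e} {+ z} _ (+≤+ e+z≤k) = fromℕ< z< , cong +_ (Fin.toℕ-fromℕ< z<)
  where
  z< : z ℕ.< k ∸ e ℕ.+ 1
  z< = subst (z ℕ.<_) (ℕ.+-comm 1 (k ∸ e)) (s≤s (ℕ.m+n≤o⇒m≤o∸n z (subst (ℕ._≤ k) (ℕ.+-comm e z) e+z≤k)))

-- The bijection between placements and triples of arrangement, position and shape

module _ {O S : PointSet} {m n p q : ℕ}
         (arr : Bijection (≡.setoid (Fin q)) (Arrangements (Vec.lookup (m ∷ n ∷ p ∷ []))))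
         (transform : IsTransformOf S O) (snug : FitsSnugly S (m ∷ n ∷ p ∷ []))
         {k : ℕ} (k≥m : k ≥ m) (k≥n : k ≥ n) (k≥p : k ≥ p) where

  private
    d : Dimensions
    d = m ∷ n ∷ p ∷ []

    module Arr = Bijection arr

  corner : Positions k m → Positions k n → Positions k p → Point
  corner a b c = + toℕ a ∷ + toℕ b ∷ + toℕ c ∷ []

  corner-within : ∀ a b c → Within d k (corner a b c)
  corner-within a b c 0F = +≤+ z≤n , position-within k≥m a
  corner-within a b c 1F = +≤+ z≤n , position-within k≥n b
  corner-within a b c 2F = +≤+ z≤n , position-within k≥p c

  corner-injective : ∀ {a b c a′ b′ c′} → corner a b c ≡ corner a′ b′ c′ → a ≡ a′ × b ≡ b′ × c ≡ c′
  corner-injective eq with x≡ , eq′ ← Vec.∷-injective eq with y≡ , eq″ ← Vec.∷-injective eq′ =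
    position≡ x≡ , position≡ y≡ , position≡ (Vec.∷-injectiveˡ eq″)
    where
    position≡ : ∀ {n} {i j : Fin n} → + toℕ i ≡ + toℕ j → i ≡ j
    position≡ = Fin.toℕ-injective ∘ ℤ.+-injective

  corner-surjective : ∀ s → Within d k s → ∃[ a ] ∃[ b ] ∃[ c ] corner a b c ≡ s
  corner-surjective (x ∷ y ∷ z ∷ []) within
    with a , refl ← within-position (proj₁ (within 0F)) (proj₂ (within 0F))
       | b , refl ← within-position (proj₁ (within 1F)) (proj₂ (within 1F))
       | c , refl ← within-position (proj₁ (within 2F)) (proj₂ (within 2F)) = a , b , c , refl

  -- The factors are nested to the left as in the product defining `Δ`, with the arrangement
  -- outside, so that the enumeration has size `q * Δ ω k m n p` by computation.
  Placing : Setoid _ _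
  Placing = ≡.setoid (Fin q) ×ₛ
    (((members (BoxOrbit S d) ×ₛ ≡.setoid (Positions k m)) ×ₛ ≡.setoid (Positions k n)) ×ₛ
     ≡.setoid (Positions k p))

  open Setoid Placing using () renaming (Carrier to Placing₀; _≈_ to _≈ₚ_)

  placement : Placing₀ → ∃ (Placements O k)
  placement (j , (((T , orbit) , a) , b) , c) =
    image (place (Arr.to j) (corner a b c)) T ,
    transform-trans (place-transform (Arr.to j) (corner a b c))
      (transform-trans (boxOrbit⇒transform d orbit) transform) ,
    place-within⇒box d k (Arr.to j) (corner a b c) (boxOrbit⇒snug d snug orbit) (corner-within a b c)

  -- The arrangement is recovered first. Equal indices then select the same representative
  -- permutation on both sides, after which position and shape follow by cancellation.
  placement-injective : ∀ x y → proj₁ (placement x) ≐ proj₁ (placement y) → x ≈ₚ y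
  placement-injective (j , (((T , orbit) , a) , b) , c) (j′ , (((T′ , orbit′) , a′) , b′) , c′) eq =
    j≡j′ , ((proj₂ cancelled , proj₁ offsets≡) , proj₁ (proj₂ offsets≡)) , proj₂ (proj₂ offsets≡)
    where
    snugT : FitsSnugly T d
    snugT = boxOrbit⇒snug d snug orbit
    snugT′ : FitsSnugly T′ d
    snugT′ = boxOrbit⇒snug d snug orbit′
    s s′ : Point
    s = corner a b c
    s′ = corner a′ b′ c′

    j≡j′ : j ≡ j′
    -- Equality in `Arrangements` is agreement of the permuted dimensions, which is all that the
    -- extrema reveal about the permutation.
    j≡j′ = Arr.injective {j} {j′} λ i → proj₂ (place-unique d (Arr.to j) (Arr.to j′) s s′ snugT snugT′ eq i)

    cancelled : s ≡ s′ × T ≐ T′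
    cancelled = place-cancel d (Arr.to j) s s′ snugT snugT′
      (subst (λ l → image (place (Arr.to j) s) T ≐ image (place (Arr.to l) s′) T′) (sym j≡j′) eq)

    offsets≡ : a ≡ a′ × b ≡ b′ × c ≡ c′
    offsets≡ = corner-injective (proj₁ cancelled)

  -- Passing through `O`, the set `U` is a transform of the snug set `S`. Its permutation is
  -- replaced by the chosen representative of the same arrangement, and the difference goes into the
  -- shape.
  placement-surjective : ∀ ((U , _) : ∃ (Placements O k)) → ∃[ x ] proj₁ (placement x) ≐ U
  placement-surjective (U , U~O , U⊆Box) =
    let signed π s , t , U≐ = transform-trans U~O (transform-sym transform)
        j , dj≡dπ = Arr.strictlySurjective π
        T , z , orbit , image≐ = transform⇒place d (Arr.to j) snug π dj≡dπ s t
        place≐U = ≐-sym (≐-trans U≐ image≐)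
        -- Containment of `U` in the cube bounds the integer offset `z`, which therefore comes from
        -- a triple of positions.
        a , b , c , corner≡z = corner-surjective z (place-box⇒within d k (Arr.to j) z
          (boxOrbit⇒snug d snug orbit) (U⊆Box ∘ proj₁ place≐U))
    in (j , (((T , orbit) , a) , b) , c) ,
       subst (λ s → image (place (Arr.to j) s) T ≐ U) (sym corner≡z) place≐U

  placement-cong : ∀ x y → x ≈ₚ y → proj₁ (placement x) ≐ proj₁ (placement y)
  placement-cong _ _ (refl , ((T≐T′ , refl) , refl) , refl) = image-cong (λ _ → refl) T≐T′

  placement-bijection : Bijection Placing (members (Placements O k))
  placement-bijection = record
    { to        = placement
    ; cong      = λ {x} {y} → placement-cong x y
    ; bijective = (λ {x} {y} → placement-injective x y)
                , λ U → let (x , ≐U) = placement-surjective U in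
                        x , λ {y} y≈x → ≐-trans (placement-cong y x y≈x) ≐U
    }

  placements-cardinality : ∀ {ω} → BoxOrbit S d hasCardinality ω →
                           Placements O k hasCardinality (q * Δ ω k m n p)
  placements-cardinality orbit = Compose.bijection
    (identity ×-enumeration (((orbit ×-enumeration identity) ×-enumeration identity) ×-enumeration identity))
    placement-bijection
    where
    identity : ∀ {n} → Bijection (≡.setoid (Fin n)) (≡.setoid (Fin n))
    identity = Identity.bijection _

-- A list of vertices makes inclusion and equality of the images decidable, as the enumeration of
-- the box orbit requires.
objects-finite : ∀ {O} →
  IsEquilateralTriangle O ⊎ IsRegularTetrahedron O ⊎ IsCube O ⊎ IsRegularOctahedron O → Finite O
objects-finite (inj₁ (xs , _ , _ , _ , O≐)) = xs , O≐
objects-finite (inj₂ (inj₁ (xs , _ , _ , _ , O≐))) = xs , O≐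
objects-finite (inj₂ (inj₂ (inj₁ (_ , _ , _ , _ , _ , O≐)))) = -, O≐
objects-finite (inj₂ (inj₂ (inj₂ (_ , _ , _ , _ , _ , _ , _ , _ , _ , O≐)))) = -, O≐

theorem2p1 : (O : PointSet) →
    IsEquilateralTriangle O ⊎ IsRegularTetrahedron O ⊎ IsCube O ⊎ IsRegularOctahedron O →
    (O′ : PointSet) (m n p : ℕ) → m ≥ n → n ≥ p →
    IsTransformOf O′ O → FitsSnugly O′ (m ∷ n ∷ p ∷ []) →
    ∃[ ω ] (BoxOrbit O′ (m ∷ n ∷ p ∷ []) hasCardinality ω ×
    ((k : ℕ) → k ≥ m →
    Placements O k hasCardinality (multiplicity (m ∸ n) (n ∸ p) * Δ ω k m n p)))
theorem2p1 O object O′ m n p m≥n n≥p transform snug = proj₁ orbit , proj₂ orbit , λ k k≥m →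
  placements-cardinality (arrangements m≥n n≥p) transform snug
    k≥m (ℕ.≤-trans m≥n k≥m) (ℕ.≤-trans n≥p (ℕ.≤-trans m≥n k≥m)) (proj₂ orbit)
  where
  orbit : ∃[ ω ] BoxOrbit O′ (m ∷ n ∷ p ∷ []) hasCardinality ω
  orbit = boxOrbit-cardinality (m ∷ n ∷ p ∷ []) (finite-transform transform (objects-finite object))
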